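{- Fix an unshifted or a shifted skew shape $\mu/\lambda$, and let $P, Q$ be two standard skew tableaux (shifted standard skew tableaux in the shifted case) of shape $\mu/\lambda$. Let $A_{P,Q}$ denote the number of tabloids $T$ of shape $\mu/\lambda$ with $\operatorname{MJ}_P(T) = Q$, i.e. such that modified jeu de taquin in $T$ with respect to $P$ results in $Q$; likewise let $A_{Q,P}$ denote the number of tabloids $T$ of shape $\mu/\lambda$ with $\operatorname{MJ}_Q(T) = P$. Then $$A_{P,Q} = A_{Q,P}.$$
   Context: **Shapes.** A partition is a sequence of integers $\lambda = (\lambda_1,\dots,\lambda_r)$ with $\lambda_1 \ge \dots \ge \lambda_r \ge 0$ (trailing zeros are allowed, so that two partitions can be written with the same number $r$ of components). Cells are pairs $(i,j)$ = (row, column), with rows numbered from top to bottom and columns from left to right. The unshifted Ferrers diagram of $\lambda$ consists of the cells $(i,j)$ with $1\le i\le r$, $1 \le j \le \lambda_i$. If the nonzero components of $\lambda$ are distinct, the shifted Ferrers diagram of $\lambda$ consists of the cells $(i,j)$ with $1\le i\le r$, $i \le j \le i+\lambda_i-1$ (each row is indented by one cell to the right with respect to the previous row). If $\mu=(\mu_1,\dots,\mu_r)$ and $\lambda=(\lambda_1,\dots,\lambda_r)$ are partitions (in the shifted case, partitions with distinct nonzero components) with $\lambda_i \le \mu_i$ for all $1\le i \le r$, the unshifted (resp. shifted) skew Ferrers diagram of shape $\mu/\lambda$ is obtained by removing the cells of the unshifted (resp. shifted) Ferrers diagram of $\lambda$ from that of $\mu$. Its number of cells is $n = |\mu/\lambda|$.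 **Tabloids and tableaux.** A tabloid of (shifted) skew shape $\mu/\lambda$ is an arbitrary filling of the cells of the (shifted) skew Ferrers diagram of $\mu/\lambda$ with $1,2,\dots,n$, each used exactly once. A (shifted) standard skew tableau is a tabloid whose entries increase along rows (left to right) and down columns (top to bottom). **Forward jeu de taquin.** Let $T$ be a tabloid and $e$ an entry of $T$. Forward jeu de taquin in $T$ with $e$ is the following procedure, where cells outside the shape are regarded as having entry $\infty$. Consider the entry to the right of $e$ and the entry below $e$; if $e$ is greater than the minimum of these two, exchange $e$ with that minimum. Repeat with $e$ in its new position until $e$ is smaller than both its right neighbour and its neighbour below. **Modified jeu de taquin.** Let $T$ be a tabloid and $S$ a (shifted) standard skew tableau of the same shape. For $1 \le k\le n$ let $e_k$ be the entry of $T$ in the cell which has label (entry) $k$ in $S$. Starting with $T$, perform successively forward jeu de taquin with $e_n$, then (in the resulting tabloid) with $e_{n-1}$, and so on, down to $e_1$. The final result, which is a (shifted) standard skew tableau, is denoted $\operatorname{MJ}_S(T)$. -}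

module Defs where

open import Data.Fin as Fin using (Fin; zero; suc; toℕ)
import Data.Fin.Properties as Fin
open import Data.Fin.Permutation
  using (Permutation′; _⟨$⟩ʳ_; _⟨$⟩ˡ_; inverseˡ; _≈_;
         id; _∘ₚ_; transpose; insert; remove; insert-punchIn; insert-remove)
import Data.Fin.Permutation.Components as Components
open import Data.List using (List; []; _∷_; length; lookup; filter; map; foldr;
  concatMap; upTo; allFin; cartesianProductWith)
open import Data.List.Membership.Propositional using (_∈_; lose)
open import Data.List.Membership.Propositional.Properties
  using (∈-map⁺; ∈-map⁻; ∈-filter⁺; ∈-filter⁻; ∈-upTo⁺; ∈-allFin; ∈-concatMap⁺; ∈-concatMap⁻)
import Data.List.Membership.Setoid as SetoidMembership
import Data.List.Membership.Setoid.Properties as SetoidMembershipₚ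
import Data.List.Relation.Unary.All as All
import Data.List.Relation.Unary.All.Properties as All
open import Data.List.Relation.Unary.AllPairs as AllPairs using ([]; _∷_)
import Data.List.Relation.Unary.AllPairs.Properties as AllPairs
open import Data.List.Relation.Unary.Any using (here; satisfied)
import Data.List.Relation.Unary.Unique.Setoid as SetoidUnique
import Data.List.Relation.Unary.Unique.Setoid.Properties as SetoidUniqueₚ
open import Data.List.Relation.Unary.Unique.Propositional using (Unique)
import Data.List.Relation.Unary.Unique.Propositional.Properties as Unique
open import Data.Nat using (ℕ; zero; suc; _+_; _≤_; _<_; z≤n; s≤s)
import Data.Nat.Properties as ℕ
open import Data.Nat.GeneralisedArithmetic using (fold)
open import Data.Product using (∃; _×_; _,_; proj₁; proj₂)
open import Data.Sum using (_⊎_; inj₁; inj₂)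
open import Level using (0ℓ)
open import Relation.Binary using (Setoid)
import Relation.Binary.Construct.Add.Supremum.NonStrict as AddSupremum
open import Relation.Binary.PropositionalEquality
  using (_≡_; _≢_; refl; sym; trans; cong; subst; setoid)
open import Relation.Nullary using (Dec; yes; no; ¬_; contradiction)
open import Relation.Nullary.Construct.Add.Supremum using (_⁺; ⊤⁺; [_])
open import Relation.Nullary.Decidable using (_×-dec_; ¬?)

data Kind : Set where
  unshifted shifted : Kind

record IsPartition (kind : Kind) {r : ℕ} (p : Fin r → ℕ) : Set where
  field
    decreasing : ∀ {i j} → i Fin.≤ j → p j ≤ p i
    distinct   : kind ≡ shifted → ∀ {i j} → i ≢ j → p i ≢ 0 → p i ≢ p j

record SkewShape (kind : Kind) : Set where
  field
    {r}         : ℕ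
    outer inner : Fin r → ℕ
    outer-part  : IsPartition kind outer
    inner-part  : IsPartition kind inner
    inner≤outer : ∀ i → inner i ≤ outer i

-- Rows and columns are numbered from 0.
indent : Kind → ∀ {r} → Fin r → ℕ
indent unshifted i = 0
indent shifted   i = toℕ i

InDiagram : Kind → ∀ {r} → (Fin r → ℕ) → Fin r → ℕ → Set
InDiagram kind p i j = indent kind i ≤ j × j < indent kind i + p i

inDiagram? : ∀ kind {r} (p : Fin r → ℕ) i j → Dec (InDiagram kind p i j)
inDiagram? kind p i j = (_ ℕ.≤? _) ×-dec (_ ℕ.<? _)

Permutations : ℕ → Setoid 0ℓ 0ℓ
Permutations n = record
  { Carrier       = Permutation′ n
  ; _≈_           = _≈_
  ; isEquivalence = record
    { refl  = λ _ → refl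
    ; sym   = λ π≈ρ i → sym (π≈ρ i)
    ; trans = λ π≈ρ ρ≈σ i → trans (π≈ρ i) (ρ≈σ i)
    }
  }

_≈?_ : ∀ {n} (π ρ : Permutation′ n) → Dec (π ≈ ρ)
π ≈? ρ = Fin.all? (λ i → (π ⟨$⟩ʳ i) Fin.≟ (ρ ⟨$⟩ʳ i))

permutations : ∀ n → List (Permutation′ n)
permutations zero    = id ∷ []
permutations (suc n) = cartesianProductWith (insert zero) (allFin (suc n)) (permutations n)

private
  insert-cong : ∀ {n} {i j : Fin (suc n)} {π ρ : Permutation′ n} → i ≡ j → π ≈ ρ →
                insert zero i π ≈ insert zero j ρ
  insert-cong refl π≈ρ zero = refl
  insert-cong {i = i} {π = π} {ρ} refl π≈ρ (suc k) =
    trans (insert-punchIn zero i π k)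
      (trans (cong (Fin.punchIn i) (π≈ρ k)) (sym (insert-punchIn zero i ρ k)))

  insert-injective : ∀ {n} {i j : Fin (suc n)} {π ρ : Permutation′ n} →
                     insert zero i π ≈ insert zero j ρ → i ≡ j × π ≈ ρ
  insert-injective {i = i} {π = π} {ρ} eq with eq zero
  ... | refl = refl , λ k → Fin.punchIn-injective i _ _
    (trans (sym (insert-punchIn zero i π k)) (trans (eq (suc k)) (insert-punchIn zero i ρ k)))

permutations-complete : ∀ {n} (π : Permutation′ n) →
                        SetoidMembership._∈_ (Permutations n) π (permutations n)
permutations-complete {zero}  π = here λ ()
permutations-complete {suc n} π =
  SetoidMembershipₚ.∈-resp-≈ (Permutations (suc n))
    {x = insert zero (π ⟨$⟩ʳ zero) (remove zero π)} {y = π} (insert-remove zero π)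
    (SetoidMembershipₚ.∈-cartesianProductWith⁺
      (setoid _) (Permutations n) (Permutations (suc n))
      (λ {i} {j} {π} {ρ} → insert-cong {i = i} {j} {π} {ρ})
      {b = remove zero π}
      (∈-allFin (π ⟨$⟩ʳ zero)) (permutations-complete (remove zero π)))

permutations-unique : ∀ n → SetoidUnique.Unique (Permutations n) (permutations n)
permutations-unique zero    = All.[] ∷ []
permutations-unique (suc n) =
  SetoidUniqueₚ.cartesianProductWith⁺
    (setoid _) (Permutations n) (Permutations (suc n)) (insert zero)
    (λ {i} {j} {π} {ρ} → insert-injective {i = i} {j} {π} {ρ})
    (Unique.allFin⁺ (suc n)) (permutations-unique n)

module Filling {n : ℕ} (row col : Fin n → ℕ) where

  -- The entries 1, …, n are represented by the elements 0, …, n - 1 of Fin n.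
  Cell Entry : Set
  Cell  = Fin n
  Entry = Fin n

  -- T ⟨$⟩ʳ c is the entry in cell c and T ⟨$⟩ˡ e is the cell containing e.
  Tabloid : Set
  Tabloid = Permutation′ n

  record StandardTableau : Set where
    field
      tabloid          : Tabloid
      rows-increase    : ∀ {c d} → row c ≡ row d → col c < col d →
                         (tabloid ⟨$⟩ʳ c) Fin.< (tabloid ⟨$⟩ʳ d)
      columns-increase : ∀ {c d} → col c ≡ col d → row c < row d →
                         (tabloid ⟨$⟩ʳ c) Fin.< (tabloid ⟨$⟩ʳ d)

  open StandardTableau

  cellAt? : ∀ i j → Dec (∃ λ c → row c ≡ i × col c ≡ j)
  cellAt? i j = Fin.any? (λ c → (row c ℕ.≟ i) ×-dec (col c ℕ.≟ j))

  entryAt : Tabloid → ℕ → ℕ → Entry ⁺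
  entryAt T i j with cellAt? i j
  ... | yes (c , _) = [ T ⟨$⟩ʳ c ]
  ... | no  _       = ⊤⁺

  rightOf below : Tabloid → Entry → Entry ⁺
  rightOf T e = entryAt T (row (T ⟨$⟩ˡ e)) (suc (col (T ⟨$⟩ˡ e)))
  below   T e = entryAt T (suc (row (T ⟨$⟩ˡ e))) (col (T ⟨$⟩ˡ e))

  infixl 7 _⊓⁺_
  _⊓⁺_ : Entry ⁺ → Entry ⁺ → Entry ⁺
  [ a ] ⊓⁺ [ b ] with a Fin.≤? b
  ... | yes _ = [ a ]
  ... | no  _ = [ b ]
  [ a ] ⊓⁺ ⊤⁺ = [ a ]
  ⊤⁺    ⊓⁺ y  = y

  exchangeIfGreater : Entry → Entry ⁺ → Tabloid → Tabloid
  exchangeIfGreater e ⊤⁺    T = T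
  exchangeIfGreater e [ m ] T with m Fin.<? e
  ... | yes _ = T ∘ₚ transpose e m
  ... | no  _ = T

  step : Entry → Tabloid → Tabloid
  step e T = exchangeIfGreater e (rightOf T e ⊓⁺ below T e) T

  -- Each exchange moves e right or down, and step e does nothing once e is
  -- smaller than its neighbours, so n steps suffice: see jdt-settled.
  jdt : Entry → Tabloid → Tabloid
  jdt e T = fold T (step e) n

  -- foldr treats the last label first.
  MJ : StandardTableau → Tabloid → Tabloid
  MJ S T = foldr (λ k → jdt (T ⟨$⟩ʳ (tabloid S ⟨$⟩ˡ k))) T (allFin n)

  A : StandardTableau → StandardTableau → ℕ
  A P Q = length (filter (λ T → MJ P T ≈? tabloid Q) (permutations n))

  open AddSupremum (Fin._≤_ {n} {n}) using (_≤⁺_; _≤⊤⁺; [_])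

  Settled : Entry → Tabloid → Set
  Settled e T = [ e ] ≤⁺ rightOf T e × [ e ] ≤⁺ below T e

  private
    ⊓⁺-sel : ∀ x y → x ⊓⁺ y ≡ x ⊎ x ⊓⁺ y ≡ y
    ⊓⁺-sel [ a ] [ b ] with a Fin.≤? b
    ... | yes _ = inj₁ refl
    ... | no  _ = inj₂ refl
    ⊓⁺-sel [ a ] ⊤⁺ = inj₁ refl
    ⊓⁺-sel ⊤⁺    y  = inj₂ refl

    ≤⊓⁺⇒≤ : ∀ {e} x y → [ e ] ≤⁺ x ⊓⁺ y → [ e ] ≤⁺ x × [ e ] ≤⁺ y
    ≤⊓⁺⇒≤ [ a ] [ b ] e≤ with a Fin.≤? b | e≤
    ... | yes a≤b | [ e≤a ] = [ e≤a ] , [ ℕ.≤-trans e≤a a≤b ]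
    ... | no  a≰b | [ e≤b ] = [ ℕ.≤-trans e≤b (ℕ.<⇒≤ (ℕ.≰⇒> a≰b)) ] , [ e≤b ]
    ≤⊓⁺⇒≤ [ a ] ⊤⁺ e≤ = e≤ , (_ ≤⊤⁺)
    ≤⊓⁺⇒≤ ⊤⁺    y  e≤ = (_ ≤⊤⁺) , e≤

    rank : Cell → ℕ
    rank c = row c + col c

    entryAt-cell : ∀ T i j {m} → entryAt T i j ≡ [ m ] → rank (T ⟨$⟩ˡ m) ≡ i + j
    entryAt-cell T i j eq with cellAt? i j
    entryAt-cell T i j refl | yes (c , refl , refl) = cong rank (inverseˡ T)

    transpose-second : ∀ {n} (i j : Fin n) → Components.transpose i j j ≡ i
    transpose-second i j with j Fin.≟ i
    ... | yes j≡i = j≡i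
    ... | no  _ with j Fin.≟ j
    ...   | yes _   = refl
    ...   | no  j≢j = contradiction refl j≢j

    step-rank : ∀ e T → Settled e T ⊎
                rank (step e T ⟨$⟩ˡ e) ≡ suc (rank (T ⟨$⟩ˡ e))
    step-rank e T with rightOf T e ⊓⁺ below T e in eq
    ... | ⊤⁺ = inj₁ (≤⊓⁺⇒≤ _ _ (subst ([ e ] ≤⁺_) (sym eq) (_ ≤⊤⁺)))
    ... | [ m ] with m Fin.<? e
    ...   | no  m≮e = inj₁ (≤⊓⁺⇒≤ _ _ (subst ([ e ] ≤⁺_) (sym eq) [ ℕ.≮⇒≥ m≮e ]))
    ...   | yes _   = inj₂ (trans (cong (λ x → rank (T ⟨$⟩ˡ x)) (transpose-second m e)) rank-m)
      where
      c = T ⟨$⟩ˡ e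
      rank-m : rank (T ⟨$⟩ˡ m) ≡ suc (rank c)
      rank-m with ⊓⁺-sel (rightOf T e) (below T e)
      ... | inj₁ sel = trans (entryAt-cell T _ _ (trans (sym sel) eq)) (ℕ.+-suc _ _)
      ... | inj₂ sel = entryAt-cell T _ _ (trans (sym sel) eq)

    ≤⁺⇒≮ : ∀ {x y} → [ x ] ≤⁺ [ y ] → ¬ (y Fin.< x)
    ≤⁺⇒≮ [ x≤y ] = ℕ.≤⇒≯ x≤y

    settled-step : ∀ e T → Settled e T → step e T ≡ T
    settled-step e T (e≤r , e≤b) with rightOf T e ⊓⁺ below T e in eq
    ... | ⊤⁺ = refl
    ... | [ m ] with m Fin.<? e
    ...   | no  _   = refl
    ...   | yes m<e with ⊓⁺-sel (rightOf T e) (below T e)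
    ...     | inj₁ sel = contradiction m<e (≤⁺⇒≮ (subst ([ e ] ≤⁺_) (trans (sym sel) eq) e≤r))
    ...     | inj₂ sel = contradiction m<e (≤⁺⇒≮ (subst ([ e ] ≤⁺_) (trans (sym sel) eq) e≤b))

    settled-or-rank : ∀ e (t : ℕ → Tabloid) → (∀ k → t (suc k) ≡ step e (t k)) →
      ∀ k → Settled e (t k) ⊎
            (∀ j → j ≤ k → rank (t j ⟨$⟩ˡ e) ≡ j + rank (t 0 ⟨$⟩ˡ e))
    settled-or-rank e t t-suc zero = inj₂ λ { zero z≤n → refl }
    settled-or-rank e t t-suc (suc k) with settled-or-rank e t t-suc k
    ... | inj₁ s = inj₁ (subst (Settled e) (sym (trans (t-suc k) (settled-step e _ s))) s)
    ... | inj₂ ranks with step-rank e (t k)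
    ...   | inj₁ s = inj₁ (subst (Settled e) (sym (trans (t-suc k) (settled-step e _ s))) s)
    ...   | inj₂ rank-suc = inj₂ λ j j≤1+k → rank≡ j (ℕ.m≤n⇒m<n∨m≡n j≤1+k)
      where
      rank≡ : ∀ j → j < suc k ⊎ j ≡ suc k → rank (t j ⟨$⟩ˡ e) ≡ j + rank (t 0 ⟨$⟩ˡ e)
      rank≡ j (inj₁ (s≤s j≤k)) = ranks j j≤k
      rank≡ j (inj₂ refl)      = trans (cong (λ T → rank (T ⟨$⟩ˡ e)) (t-suc k))
                                       (trans rank-suc (cong suc (ranks k ℕ.≤-refl)))

    settled-by-n : ∀ e (t : ℕ → Tabloid) → (∀ k → t (suc k) ≡ step e (t k)) → Settled e (t n)
    settled-by-n e t t-suc with settled-or-rank e t t-suc n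
    ... | inj₁ s = s
    ... | inj₂ ranks with Fin.pigeonhole (ℕ.n<1+n n) (λ j → t (toℕ j) ⟨$⟩ˡ e)
    ...   | i , j , i<j , same = contradiction
      (ℕ.+-cancelʳ-≡ _ _ _ (trans (sym (ranks (toℕ i) (Fin.toℕ≤pred[n] i)))
        (trans (cong rank same) (ranks (toℕ j) (Fin.toℕ≤pred[n] j)))))
      (ℕ.<⇒≢ i<j)

  jdt-settled : ∀ e T → Settled e (jdt e T)
  jdt-settled e T = settled-by-n e (fold T (step e)) (λ _ → refl)

module _ {kind : Kind} (shape : SkewShape kind) where
  open SkewShape shape

  InShape : Fin r → ℕ → Set
  InShape i j = InDiagram kind outer i j × ¬ InDiagram kind inner i j

  inShape? : ∀ i j → Dec (InShape i j)
  inShape? i j = inDiagram? kind outer i j ×-dec ¬? (inDiagram? kind inner i j)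

  rowCells : Fin r → List (Fin r × ℕ)
  rowCells i = map (i ,_) (filter (inShape? i) (upTo (indent kind i + outer i)))

  cells : List (Fin r × ℕ)
  cells = concatMap rowCells (allFin r)

  ∈-cells⁺ : ∀ {i j} → InShape i j → (i , j) ∈ cells
  ∈-cells⁺ {i} {j} ij∈ = ∈-concatMap⁺ rowCells (lose (∈-allFin i)
    (∈-map⁺ (i ,_) (∈-filter⁺ (inShape? i) (∈-upTo⁺ (proj₂ (proj₁ ij∈))) ij∈)))

  ∈-cells⁻ : ∀ {i j} → (i , j) ∈ cells → InShape i j
  ∈-cells⁻ ij∈ with satisfied (∈-concatMap⁻ rowCells {xs = allFin r} ij∈)
  ... | i , ij∈row with ∈-map⁻ (i ,_) ij∈row
  ... | j , j∈ , refl = proj₂ (∈-filter⁻ (inShape? i) {xs = upTo (indent kind i + outer i)} j∈)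

  cells-unique : Unique cells
  cells-unique = Unique.concat⁺
    (All.map⁺ (All.universal (λ i → Unique.map⁺ (cong proj₂)
      (Unique.filter⁺ (inShape? i) (Unique.upTo⁺ (indent kind i + outer i)))) (allFin r)))
    (AllPairs.map⁺ (AllPairs.map disjoint (Unique.allFin⁺ r)))
    where
    disjoint : ∀ {i i′} → i ≢ i′ → ∀ {c} → ¬ (c ∈ rowCells i × c ∈ rowCells i′)
    disjoint i≢i′ (c∈ , c∈′) with ∈-map⁻ _ c∈ | ∈-map⁻ _ c∈′
    ... | _ , _ , refl | _ , _ , refl = i≢i′ refl

  size : ℕ
  size = length cells

  -- A cell is represented by its position in the list of cells.
  row col : Fin size → ℕ
  row c = toℕ (proj₁ (lookup cells c))
  col c = proj₂ (lookup cells c)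

  open Filling row col public

-- For a permutation e of the entries, MJ_P sends the tabloid with entry e k in
-- the cell labelled k to Q exactly when MJ_Q sends the tabloid with entry e⁻¹ j
-- in the cell labelled j to P; this gives A_{P,Q} = A_{Q,P}.  Indeed, forward
-- jeu de taquin with e k amounts to going through the entries j < e k in
-- increasing order and exchanging e k with j whenever j lies immediately to the
-- right of or below e k.  Record the cells of e k and j before and after each of
-- these potential exchanges in a square labelled (k , j).  The squares fit
-- together into a grid with P and Q on its sides, the rule relating the four
-- cells of a square is symmetric in the two indices, and the grid is determined
-- by P and e.

module Submission where

open import Defs
  using (Permutations; permutations; permutations-complete; permutations-unique; _≈?_; module Filling)
open import Data.Fin as Fin using (Fin; toℕ; fromℕ<)
import Data.Fin.Properties as Fin
open import Data.Fin.Permutation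
  using (Permutation′; _⟨$⟩ʳ_; _⟨$⟩ˡ_; inverseˡ; inverseʳ; _≈_; _∘ₚ_; flip; transpose)
import Data.Fin.Permutation.Components as Components
open import Data.List using (_∷_; length; lookup; filter; foldr; drop; tabulate; allFin)
open import Data.List.Membership.Propositional.Properties using (∈-lookup)
import Data.List.Membership.Setoid as SetoidMembership
import Data.List.Membership.Setoid.Properties as SetoidMembershipₚ
import Data.List.Properties as List
import Data.List.Relation.Unary.All as All
open import Data.List.Relation.Unary.AllPairs using (_∷_)
import Data.List.Relation.Unary.Unique.Setoid as SetoidUnique
import Data.List.Relation.Unary.Unique.Setoid.Properties as SetoidUniqueₚ
open import Data.Nat using (ℕ; zero; suc; _+_; _∸_; _≤_; _<_; z≤n; s≤s; _<?_)
open import Data.Nat.GeneralisedArithmetic using (fold; fold-+)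
import Data.Nat.Properties as ℕ
open import Data.Product using (∃; _×_; _,_; proj₁; proj₂)
open import Data.Sum using (_⊎_; inj₁; inj₂)
open import Function using (_∘_)
open import Level using (0ℓ)
open import Relation.Binary using (Rel; Setoid; Tri; tri<; tri≈; tri>)
import Relation.Binary.Construct.Add.Supremum.NonStrict as AddSupremum
open import Relation.Binary.PropositionalEquality
  using (_≡_; _≢_; refl; sym; trans; cong; cong₂; subst; subst₂; setoid; module ≡-Reasoning)
open import Relation.Nullary using (Dec; yes; no; ¬_; contradiction)
open import Relation.Nullary.Construct.Add.Supremum using (⊤⁺; [_])
open import Relation.Nullary.Decidable using (_×-dec_; _⊎-dec_)

-- Induction over bounded ranges and counting by injections.

-- States of the process are indexed by 0, ..., n but its moves by `Fin n`; hence the induction step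
-- is asked only at elements of `Fin n`.
ascending : ∀ {n} (B : ℕ → Set) → B 0 → (∀ (i : Fin n) → B (toℕ i) → B (suc (toℕ i))) →
            ∀ {j} → j ≤ n → B j
ascending B base next {zero}  _   = base
ascending B base next {suc j} j<n =
  subst (B ∘ suc) (Fin.toℕ-fromℕ< j<n)
    (next (fromℕ< j<n) (subst B (sym (Fin.toℕ-fromℕ< j<n)) (ascending B base next (ℕ.<⇒≤ j<n))))

descending : ∀ {n} (B : ℕ → Set) → B n → (∀ (i : Fin n) → B (suc (toℕ i)) → B (toℕ i)) →
             ∀ {j} → j ≤ n → B j
descending {n} B base next {j} j≤n =
  subst B (ℕ.m∸[m∸n]≡n j≤n) (ascending (λ i → B (n ∸ i)) base below (ℕ.m∸n≤m n j))
  where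
  below : ∀ (i : Fin n) → B (n ∸ toℕ i) → B (n ∸ suc (toℕ i))
  below i b = subst B (Fin.opposite-prop i)
    (next (Fin.opposite i) (subst B (sym suc-opposite) b))
    where
    suc-opposite : suc (toℕ (Fin.opposite i)) ≡ n ∸ toℕ i
    suc-opposite = trans (cong suc (Fin.opposite-prop i)) (sym (ℕ.+-∸-assoc 1 (Fin.toℕ<n i)))

drop-tabulate : ∀ {A : Set} {n} (f : Fin n → A) i →
                drop (toℕ i) (tabulate f) ≡ f i ∷ drop (suc (toℕ i)) (tabulate f)
drop-tabulate f Fin.zero    = refl
drop-tabulate f (Fin.suc i) = drop-tabulate (f ∘ Fin.suc) i

module _ (S : Setoid 0ℓ 0ℓ) where
  open Setoid S using (Carrier) renaming (_≈_ to _≈ₛ_; sym to symₛ)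

  lookup-injective : ∀ {xs} → SetoidUnique.Unique S xs →
                     ∀ {i j} → lookup xs i ≈ₛ lookup xs j → i ≡ j
  lookup-injective (x∉ ∷ u) {Fin.zero}  {Fin.zero}  eq = refl
  lookup-injective (x∉ ∷ u) {Fin.zero}  {Fin.suc j} eq = contradiction eq (All.lookup x∉ (∈-lookup j))
  lookup-injective (x∉ ∷ u) {Fin.suc i} {Fin.zero}  eq = contradiction (symₛ eq) (All.lookup x∉ (∈-lookup i))
  lookup-injective (x∉ ∷ u) {Fin.suc i} {Fin.suc j} eq = cong Fin.suc (lookup-injective u eq)

  open SetoidMembership S using (_∈_)

  -- Since `xs` has no repetitions, sending a position in `xs` to the position of its image in `ys`
  -- is injective, and the pigeonhole principle compares the lengths. A setoid is used because
  -- permutations are compared pointwise.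
  length-injection : ∀ {xs ys} (f : Carrier → Carrier) → SetoidUnique.Unique S xs →
                     (∀ {x y} → f x ≈ₛ f y → x ≈ₛ y) → (∀ {x} → x ∈ xs → f x ∈ ys) →
                     length xs ≤ length ys
  length-injection {xs} f unique f-injective f∈ = Fin.injective⇒≤ λ {i} {j} eq →
    lookup-injective unique (f-injective
      (SetoidMembershipₚ.index-injective S (f∈ (lookup∈ i)) (f∈ (lookup∈ j)) eq))
    where
    lookup∈ : ∀ i → lookup xs i ∈ xs
    lookup∈ = SetoidMembershipₚ.∈-lookup S xs

-- Transpositions and inverse permutations.

transpose-first : ∀ {n} (i j : Fin n) → Components.transpose i j i ≡ j
transpose-first i j with i Fin.≟ i
... | yes _   = refl
... | no  i≢i = contradiction refl i≢i

transpose-second : ∀ {n} (i j : Fin n) → Components.transpose i j j ≡ i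
transpose-second i j with j Fin.≟ i
... | yes j≡i = j≡i
... | no  _ with j Fin.≟ j
...   | yes _   = refl
...   | no  j≢j = contradiction refl j≢j

transpose-other : ∀ {n} {i j k : Fin n} → k ≢ i → k ≢ j → Components.transpose i j k ≡ k
transpose-other {i = i} {j} {k} k≢i k≢j with k Fin.≟ i
... | yes k≡i = contradiction k≡i k≢i
... | no  _ with k Fin.≟ j
...   | yes k≡j = contradiction k≡j k≢j
...   | no  _   = refl

≈-inverse : ∀ {n} {π ρ : Permutation′ n} → π ≈ ρ → ∀ i → π ⟨$⟩ˡ i ≡ ρ ⟨$⟩ˡ i
≈-inverse {π = π} {ρ} π≈ρ i = begin
  π ⟨$⟩ˡ i                         ≡⟨ cong (π ⟨$⟩ˡ_) (inverseʳ ρ) ⟨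
  π ⟨$⟩ˡ (ρ ⟨$⟩ʳ (ρ ⟨$⟩ˡ i))      ≡⟨ cong (π ⟨$⟩ˡ_) (π≈ρ (ρ ⟨$⟩ˡ i)) ⟨
  π ⟨$⟩ˡ (π ⟨$⟩ʳ (ρ ⟨$⟩ˡ i))      ≡⟨ inverseˡ π ⟩
  ρ ⟨$⟩ˡ i                         ∎
  where open ≡-Reasoning

inverse-≈ : ∀ {n} {π ρ : Permutation′ n} → (∀ i → π ⟨$⟩ˡ i ≡ ρ ⟨$⟩ˡ i) → π ≈ ρ
inverse-≈ {π = π} {ρ} = ≈-inverse {π = flip π} {flip ρ}

⟨$⟩ʳ-injective : ∀ {n} (π : Permutation′ n) {i j} → π ⟨$⟩ʳ i ≡ π ⟨$⟩ʳ j → i ≡ j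
⟨$⟩ʳ-injective π eq = trans (sym (inverseˡ π)) (trans (cong (π ⟨$⟩ˡ_) eq) (inverseˡ π))

-- Grids of squares, their transposes and their uniqueness.

module Grids {n : ℕ} (_⇝_ : Rel (Fin n) 0ℓ) where

  -- The condition ¬ (x ⇝ y), which holds automatically in a run of modified jeu
  -- de taquin, makes the rule symmetric under (y , x) ↔ (x′ , y′).
  data Square (y x : Fin n) : Fin n → Fin n → Set where
    swap : y ⇝ x → Square y x x y
    pass : ¬ (y ⇝ x) → ¬ (x ⇝ y) → Square y x y x

  -- In a swap x′ = y and y′ = x, so transposition returns the same square; in a pass it exchanges
  -- the two conditions.
  square-transpose : ∀ {y x y′ x′} → Square y x y′ x′ → Square x′ y′ x y
  square-transpose (swap y⇝x)      = swap y⇝x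
  square-transpose (pass y⇝̸x x⇝̸y) = pass x⇝̸y y⇝̸x

  square-deterministic : ∀ {y x y′ x′ y″ x″} → Square y x y′ x′ → Square y x y″ x″ →
                         y′ ≡ y″ × x′ ≡ x″
  square-deterministic (swap _)     (swap _)     = refl , refl
  square-deterministic (swap y⇝x)   (pass y⇝̸x _) = contradiction y⇝x y⇝̸x
  square-deterministic (pass y⇝̸x _) (swap y⇝x)   = contradiction y⇝x y⇝̸x
  square-deterministic (pass _ _)   (pass _ _)   = refl , refl

  -- X k j is the cell of entry j after the moves of e (n - 1), …, e k, and Y k j
  -- is the cell of e k after it has been compared with the entries below j.
  record Grid (P Q e : Permutation′ n) : Set where
    field
      X      : ℕ → Fin n → Fin n
      Y      : Fin n → ℕ → Fin n
      start  : ∀ k → Y k 0 ≡ P ⟨$⟩ˡ k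
      end    : ∀ j → X 0 j ≡ Q ⟨$⟩ˡ j
      turn   : ∀ k → X (toℕ k) (e ⟨$⟩ʳ k) ≡ Y k (toℕ (e ⟨$⟩ʳ k))
      square : ∀ {k j} → j Fin.< e ⟨$⟩ʳ k → k Fin.< e ⟨$⟩ˡ j →
               Square (Y k (toℕ j)) (X (suc (toℕ k)) j) (Y k (suc (toℕ j))) (X (toℕ k) j)
      Y-pass : ∀ {k j} → j Fin.< e ⟨$⟩ʳ k → e ⟨$⟩ˡ j Fin.< k → Y k (suc (toℕ j)) ≡ Y k (toℕ j)
      X-pass : ∀ {k j} → k Fin.< e ⟨$⟩ˡ j → e ⟨$⟩ʳ k Fin.< j → X (suc (toℕ k)) j ≡ X (toℕ k) j

  -- `start` and `end` are transposes of each other, as are `Y-pass` and `X-pass`, and squares are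
  -- handled by `square-transpose`. Only `turn` has to be reindexed, by k = e⁻¹ j.
  grid-transpose : ∀ {P Q e} → Grid P Q e → Grid Q P (flip e)
  grid-transpose {e = e} G = record
    { X      = λ j k → Y k j
    ; Y      = λ j k → X k j
    ; start  = end
    ; end    = start
    ; turn   = λ j → sym (subst (λ i → X (toℕ (e ⟨$⟩ˡ j)) i ≡ Y (e ⟨$⟩ˡ j) (toℕ i))
                                (inverseʳ e) (turn (e ⟨$⟩ˡ j)))
    ; square = λ k<f j<e → square-transpose (square j<e k<f)
    ; Y-pass = X-pass
    ; X-pass = Y-pass
    }
    where open Grid G

  -- Row k is computed from the row above it: `Y k` begins at `start` and advances through the
  -- entries in increasing order, each square being determined by its two inputs. Descending from k
  -- = n to k = 0 reaches `end`.
  grid-unique : ∀ {P Q Q′ e e′} → e ≈ e′ → Grid P Q e → Grid P Q′ e′ → Q ≈ Q′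
  grid-unique {P} {Q} {Q′} {e} {e′} e≈e′ G G′ = inverse-≈ {π = Q} {Q′} λ j →
    trans (sym (G.end j))
      (trans (descending SameX (λ j n≤f → contradiction (Fin.toℕ<n (e ⟨$⟩ˡ j)) (ℕ.≤⇒≯ n≤f))
                         sameX z≤n j z≤n)
             (G′.end j))
    where
    module G  = Grid G
    module G′ = Grid G′

    -- The fields of a grid constrain `X k j` only for k ≤ e⁻¹ j. At k = n this range is empty, so
    -- the descent starts vacuously; at k = 0 it contains every entry.
    SameX : ℕ → Set
    SameX k = ∀ j → k ≤ toℕ (e ⟨$⟩ˡ j) → G.X k j ≡ G′.X k j

    e′-bound : ∀ {k j} → j Fin.< e ⟨$⟩ʳ k → j Fin.< e′ ⟨$⟩ʳ k
    e′-bound {k} {j} = subst (j Fin.<_) (e≈e′ k)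

    f≡f′ : ∀ j → e ⟨$⟩ˡ j ≡ e′ ⟨$⟩ˡ j
    f≡f′ = ≈-inverse {π = e} {e′} e≈e′

    sameX : ∀ k → SameX (suc (toℕ k)) → SameX (toℕ k)
    sameX k above = goal
      where
      same-square : ∀ {j} → j Fin.< e ⟨$⟩ʳ k → k Fin.< e ⟨$⟩ˡ j →
                    G.Y k (toℕ j) ≡ G′.Y k (toℕ j) →
                    G.Y k (suc (toℕ j)) ≡ G′.Y k (suc (toℕ j)) × G.X (toℕ k) j ≡ G′.X (toℕ k) j
      same-square {j} j<e k<f sameYj = square-deterministic (G.square j<e k<f)
        (subst₂ (λ y x → Square y x _ _) (sym sameYj) (sym (above j k<f))
          (G′.square (e′-bound j<e) (subst (k Fin.<_) (f≡f′ j) k<f)))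

      sameY : ∀ {j} → j ≤ n → j ≤ toℕ (e ⟨$⟩ʳ k) → G.Y k j ≡ G′.Y k j
      sameY = ascending (λ j → j ≤ toℕ (e ⟨$⟩ʳ k) → G.Y k j ≡ G′.Y k j)
        (λ _ → trans (G.start k) (sym (G′.start k))) next
        where
        next : ∀ (j : Fin n) → (toℕ j ≤ toℕ (e ⟨$⟩ʳ k) → G.Y k (toℕ j) ≡ G′.Y k (toℕ j)) →
               j Fin.< e ⟨$⟩ʳ k → G.Y k (suc (toℕ j)) ≡ G′.Y k (suc (toℕ j))
        next j ih j<e with Fin.<-cmp k (e ⟨$⟩ˡ j)
        ... | tri< k<f _ _ = proj₁ (same-square j<e k<f (ih (ℕ.<⇒≤ j<e)))
        ... | tri≈ _ refl _ = contradiction (sym (cong toℕ (inverseʳ e))) (ℕ.<⇒≢ j<e)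
        ... | tri> _ _ f<k = trans (G.Y-pass j<e f<k) (trans (ih (ℕ.<⇒≤ j<e))
          (sym (G′.Y-pass (e′-bound j<e) (subst (Fin._< k) (f≡f′ j) f<k))))

      goal : SameX (toℕ k)
      -- The value in row k comes from a square, from `turn` or from `X-pass`, according as j is
      -- less than, equal to or greater than `e ⟨$⟩ʳ k`.
      goal j k≤f = compare (Fin.<-cmp j (e ⟨$⟩ʳ k))
        where
        k<f : j ≢ e ⟨$⟩ʳ k → k Fin.< e ⟨$⟩ˡ j
        k<f j≢e = ℕ.≤∧≢⇒< k≤f λ k≡f →
          j≢e (trans (sym (inverseʳ e)) (cong (e ⟨$⟩ʳ_) (sym (Fin.toℕ-injective k≡f))))
        compare : Tri (j Fin.< e ⟨$⟩ʳ k) (j ≡ e ⟨$⟩ʳ k) (e ⟨$⟩ʳ k Fin.< j) →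
                  G.X (toℕ k) j ≡ G′.X (toℕ k) j
        compare (tri< j<e j≢e _) =
          proj₂ (same-square j<e (k<f j≢e) (sameY (ℕ.<⇒≤ (Fin.toℕ<n j)) (ℕ.<⇒≤ j<e)))
        compare (tri≈ _ refl _) =
          trans (G.turn k) (trans (sameY (ℕ.<⇒≤ (Fin.toℕ<n j)) ℕ.≤-refl)
            (sym (subst (λ i → G′.X (toℕ k) i ≡ G′.Y k (toℕ i)) (sym (e≈e′ k)) (G′.turn k))))
        compare (tri> _ j≢e e<j) =
          trans (sym (G.X-pass (k<f j≢e) e<j)) (trans (above j (k<f j≢e))
            (G′.X-pass (subst (k Fin.<_) (f≡f′ j) (k<f j≢e)) (subst (Fin._< j) (e≈e′ k) e<j)))

-- Jeu de taquin as a sweep through the entries in increasing order.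

module Symmetry {n : ℕ} (row col : Fin n → ℕ)
                (cell-injective : ∀ {c d} → row c ≡ row d → col c ≡ col d → c ≡ d) where

  open Filling row col
  open StandardTableau
  open AddSupremum (Fin._≤_ {n} {n}) using (_≤⁺_; _≤⊤⁺; [_])

  infix 4 _⇝_ _⇝?_

  _⇝_ : Rel Cell 0ℓ
  c ⇝ d = (row d ≡ row c × col d ≡ suc (col c)) ⊎ (row d ≡ suc (row c) × col d ≡ col c)

  _⇝?_ : ∀ c d → Dec (c ⇝ d)
  c ⇝? d = ((row d ℕ.≟ row c) ×-dec (col d ℕ.≟ suc (col c)))
       ⊎-dec ((row d ℕ.≟ suc (row c)) ×-dec (col d ℕ.≟ col c))

  open Grids _⇝_

  ⇝-increases : ∀ P {c d} → c ⇝ d → tabloid P ⟨$⟩ʳ c Fin.< tabloid P ⟨$⟩ʳ d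
  ⇝-increases P (inj₁ (r , s)) = rows-increase P (sym r) (ℕ.≤-reflexive (sym s))
  ⇝-increases P (inj₂ (r , s)) = columns-increase P (sym s) (ℕ.≤-reflexive (sym r))

  entryAt-cell : ∀ T {i j} d → row d ≡ i → col d ≡ j → entryAt T i j ≡ [ T ⟨$⟩ʳ d ]
  entryAt-cell T {i} {j} d r s with cellAt? i j
  ... | yes (c , r′ , s′) =
    cong (λ b → [ T ⟨$⟩ʳ b ]) (cell-injective (trans r′ (sym r)) (trans s′ (sym s)))
  ... | no ¬cell = contradiction (d , r , s) ¬cell

  entryAt-bound : ∀ T i j {v} → (∀ d → row d ≡ i → col d ≡ j → v Fin.≤ T ⟨$⟩ʳ d) →
                  [ v ] ≤⁺ entryAt T i j
  entryAt-bound T i j v≤ with cellAt? i j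
  ... | yes (c , r , s) = [ v≤ c r s ]
  ... | no  _           = _ ≤⊤⁺

  ⊓⁺-glb : ∀ {v} x y → [ v ] ≤⁺ x → [ v ] ≤⁺ y → [ v ] ≤⁺ x ⊓⁺ y
  ⊓⁺-glb [ a ] [ b ] v≤a v≤b with a Fin.≤? b
  ... | yes _ = v≤a
  ... | no  _ = v≤b
  ⊓⁺-glb [ a ] ⊤⁺ v≤a _   = v≤a
  ⊓⁺-glb ⊤⁺    y  _   v≤y = v≤y

  ⊓⁺-minˡ : ∀ {v} y → [ v ] ≤⁺ y → [ v ] ⊓⁺ y ≡ [ v ]
  ⊓⁺-minˡ {v} [ b ] [ v≤b ] with v Fin.≤? b
  ... | yes _   = refl
  ... | no  v≰b = contradiction v≤b v≰b
  ⊓⁺-minˡ ⊤⁺ _ = refl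

  ⊓⁺-minʳ : ∀ {v} x → [ v ] ≤⁺ x → x ⊓⁺ [ v ] ≡ [ v ]
  ⊓⁺-minʳ {v} [ a ] [ v≤a ] with a Fin.≤? v
  ... | yes a≤v = cong [_] (Fin.≤-antisym a≤v v≤a)
  ... | no  _   = refl
  ⊓⁺-minʳ ⊤⁺ _ = refl

  SuccessorsFrom : Entry → Tabloid → ℕ → Set
  SuccessorsFrom e T j = ∀ d → (T ⟨$⟩ˡ e) ⇝ d → j ≤ toℕ (T ⟨$⟩ʳ d)

  rightOf-bound : ∀ T e {v} → SuccessorsFrom e T (toℕ v) → [ v ] ≤⁺ rightOf T e
  rightOf-bound T e v≤ = entryAt-bound T _ _ λ d r s → v≤ d (inj₁ (r , s))

  below-bound : ∀ T e {v} → SuccessorsFrom e T (toℕ v) → [ v ] ≤⁺ below T e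
  below-bound T e v≤ = entryAt-bound T _ _ λ d r s → v≤ d (inj₂ (r , s))

  least-successor : ∀ T e v → (T ⟨$⟩ˡ e) ⇝ (T ⟨$⟩ˡ v) → SuccessorsFrom e T (toℕ v) →
                    rightOf T e ⊓⁺ below T e ≡ [ v ]
  least-successor T e v (inj₁ (r , s)) v≤
    rewrite trans (entryAt-cell T (T ⟨$⟩ˡ v) r s) (cong [_] (inverseʳ T))
    = ⊓⁺-minˡ _ (below-bound T e v≤)
  least-successor T e v (inj₂ (r , s)) v≤
    rewrite trans (entryAt-cell T (T ⟨$⟩ˡ v) r s) (cong [_] (inverseʳ T))
    = ⊓⁺-minʳ _ (rightOf-bound T e v≤)

  step-exchange : ∀ T {e v} → (T ⟨$⟩ˡ e) ⇝ (T ⟨$⟩ˡ v) → SuccessorsFrom e T (toℕ v) →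
                  v Fin.< e → step e T ≡ T ∘ₚ transpose e v
  step-exchange T {e} {v} e⇝v v≤ v<e rewrite least-successor T e v e⇝v v≤ with v Fin.<? e
  ... | yes _   = refl
  ... | no  v≮e = contradiction v<e v≮e

  exchangeIfGreater-≤ : ∀ {e} x T → [ e ] ≤⁺ x → exchangeIfGreater e x T ≡ T
  exchangeIfGreater-≤ ⊤⁺ T _ = refl
  exchangeIfGreater-≤ {e} [ m ] T [ e≤m ] with m Fin.<? e
  ... | yes m<e = contradiction m<e (ℕ.≤⇒≯ e≤m)
  ... | no  _   = refl

  step-settled : ∀ T {e} → SuccessorsFrom e T (toℕ e) → step e T ≡ T
  step-settled T {e} e≤ = exchangeIfGreater-≤ _ T
    (⊓⁺-glb _ _ (rightOf-bound T e e≤) (below-bound T e e≤))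

  -- One comparison looks only at the position of v and takes no minimum. That v is the least
  -- neighbour will follow from visiting the entries in increasing order.
  data Exchange (e v : Entry) (T : Tabloid) : Tabloid → Set where
    exchanged : (T ⟨$⟩ˡ e) ⇝ (T ⟨$⟩ˡ v) → Exchange e v T (T ∘ₚ transpose e v)
    kept      : ¬ ((T ⟨$⟩ˡ e) ⇝ (T ⟨$⟩ˡ v)) → Exchange e v T T

  exchange? : ∀ e v T → ∃ (Exchange e v T)
  exchange? e v T with (T ⟨$⟩ˡ e) ⇝? (T ⟨$⟩ˡ v)
  ... | yes e⇝v = _ , exchanged e⇝v
  ... | no  e⇝̸v = _ , kept e⇝̸v

  -- Whereas `jdt` passes only through the exchanges actually made, `sweep` has a state for every j,
  -- as the grid requires. From n on it stays constant, which makes it total in j.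
  sweep : Entry → Tabloid → ℕ → Tabloid
  sweep e T zero = T
  sweep e T (suc j) with j <? n
  ... | yes j<n = proj₁ (exchange? e (fromℕ< j<n) (sweep e T j))
  ... | no  _   = sweep e T j

  sweep-suc : ∀ e T v → Exchange e v (sweep e T (toℕ v)) (sweep e T (suc (toℕ v)))
  sweep-suc e T v with toℕ v <? n
  ... | yes v<n = subst (λ u → Exchange e u S (proj₁ (exchange? e (fromℕ< v<n) S)))
                        (Fin.fromℕ<-toℕ v v<n) (proj₂ (exchange? e (fromℕ< v<n) S))
    where S = sweep e T (toℕ v)
  ... | no  v≮n = contradiction (Fin.toℕ<n v) v≮n

  exchange-other : ∀ {e v T T′ u} → u ≢ e → u ≢ v → Exchange e v T T′ → T′ ⟨$⟩ˡ u ≡ T ⟨$⟩ˡ u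
  exchange-other {T = T} u≢e u≢v (exchanged _) = cong (T ⟨$⟩ˡ_) (transpose-other u≢v u≢e)
  exchange-other u≢e u≢v (kept _) = refl

  -- The hypothesis supplies the second condition of `pass`.
  exchange-square : ∀ {e v T T′} → ¬ ((T ⟨$⟩ˡ v) ⇝ (T ⟨$⟩ˡ e)) → Exchange e v T T′ →
                    Square (T ⟨$⟩ˡ e) (T ⟨$⟩ˡ v) (T′ ⟨$⟩ˡ e) (T′ ⟨$⟩ˡ v)
  exchange-square {e} {v} {T} _ (exchanged e⇝v) =
    subst₂ (λ i j → Square (T ⟨$⟩ˡ e) (T ⟨$⟩ˡ v) (T ⟨$⟩ˡ i) (T ⟨$⟩ˡ j))
           (sym (transpose-second v e)) (sym (transpose-first v e)) (swap e⇝v)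
  exchange-square v⇝̸e (kept e⇝̸v) = pass e⇝̸v v⇝̸e

  -- An entry u other than e can move only when e is compared with u itself, which the range from i
  -- to j avoids.
  sweep-keeps : ∀ {e T u i j} → u ≢ e → i ≤ j → j ≤ n →
                (∀ {v} → i ≤ toℕ v → toℕ v < j → u ≢ v) →
                sweep e T j ⟨$⟩ˡ u ≡ sweep e T i ⟨$⟩ˡ u
  sweep-keeps {e} {T} {u} {i} u≢e i≤j j≤n = ascending Kept base next j≤n i≤j
    where
    Kept : ℕ → Set
    Kept j = i ≤ j → (∀ {v} → i ≤ toℕ v → toℕ v < j → u ≢ v) →
             sweep e T j ⟨$⟩ˡ u ≡ sweep e T i ⟨$⟩ˡ u
    base : Kept 0
    base z≤n _ = refl
    next : ∀ (v : Fin n) → Kept (toℕ v) → Kept (suc (toℕ v))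
    next v ih i≤1+v u≢ with ℕ.m≤n⇒m<n∨m≡n i≤1+v
    ... | inj₂ refl     = refl
    ... | inj₁ (s≤s i≤v) = trans (exchange-other u≢e (u≢ i≤v ℕ.≤-refl) (sweep-suc e T v))
                                 (ih i≤v λ i≤w w<v → u≢ i≤w (ℕ.m<n⇒m<1+n w<v))

  -- Invariants of a run of modified jeu de taquin.

  module Run (P : StandardTableau) (T : Tabloid) where

    label : Cell → ℕ
    label c = toℕ (tabloid P ⟨$⟩ʳ c)

    -- The permutation e of the grid. Its inverse sends an entry to the label of the cell in which
    -- that entry starts.
    entries : Permutation′ n
    entries = flip (tabloid P) ∘ₚ T

    entry : Fin n → Entry
    entry k = entries ⟨$⟩ʳ k

    ⇝⇒label< : ∀ {c d} → c ⇝ d → label c < label d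
    ⇝⇒label< = ⇝-increases P

    ⇝-irreflexive : ∀ {c d} → c ⇝ d → c ≢ d
    ⇝-irreflexive c⇝d refl = ℕ.<-irrefl refl (⇝⇒label< c⇝d)

    Initial : ℕ → Tabloid → Set
    Initial k S = ∀ {c} → label c < k → S ⟨$⟩ʳ c ≡ T ⟨$⟩ʳ c

    initial-cell : ∀ {k S v} → Initial k S → toℕ (entries ⟨$⟩ˡ v) < k → S ⟨$⟩ˡ v ≡ T ⟨$⟩ˡ v
    initial-cell {S = S} initial f<k =
      trans (cong (S ⟨$⟩ˡ_) (sym (trans (initial f<k) (inverseʳ T)))) (inverseˡ S)

    -- The state after the moves of the entries with labels n - 1, ..., k. Labels grow along `⇝`, so
    -- the cells labelled at least k are closed under moving right and down, and the slides never
    -- disturb the other cells.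
    record Sorted (k : ℕ) (S : Tabloid) : Set where
      field
        sorted  : ∀ {c d} → c ⇝ d → k ≤ label c → S ⟨$⟩ʳ c Fin.< S ⟨$⟩ʳ d
        initial : Initial k S

    -- The state in which entry k has been compared with the entries below j.
    record Sweeping (k : Fin n) (j : ℕ) (S : Tabloid) : Set where
      field
        hole    : ∀ {c} → S ⟨$⟩ʳ c ≡ entry k → toℕ k ≤ label c
        sorted  : ∀ {c d} → c ⇝ d → toℕ k ≤ label c → S ⟨$⟩ʳ c ≢ entry k → S ⟨$⟩ʳ d ≢ entry k →
                  S ⟨$⟩ʳ c Fin.< S ⟨$⟩ʳ d
        before  : ∀ {c d} → c ⇝ d → toℕ k ≤ label c → S ⟨$⟩ʳ d ≡ entry k → toℕ (S ⟨$⟩ʳ c) < j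
        after   : ∀ {c d} → c ⇝ d → S ⟨$⟩ʳ c ≡ entry k → j ≤ toℕ (S ⟨$⟩ʳ d)
        initial : Initial (toℕ k) S

      successors : SuccessorsFrom (entry k) S j
      successors d e⇝d = after e⇝d (inverseʳ S)

      -- Cells labelled below k still hold their entries of `T`, so an entry that started elsewhere
      -- cannot be found in them.
      inside : ∀ {v} → toℕ k ≤ toℕ (entries ⟨$⟩ˡ v) → toℕ k ≤ label (S ⟨$⟩ˡ v)
      inside {v} k≤f = ℕ.≮⇒≥ λ l<k → ℕ.≤⇒≯ k≤f
        (subst (λ c → label c < toℕ k)
          (⟨$⟩ʳ-injective T (trans (sym (initial l<k)) (trans (inverseʳ S) (sym (inverseʳ T))))) l<k)

    -- `entry k` still sits in the cell labelled k. The predecessors of that cell have smaller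
    -- labels, which makes `before` vacuous.
    sweeping-start : ∀ k {S} → Sorted (suc (toℕ k)) S → Sweeping k 0 S
    sweeping-start k {S} S-sorted = record
      { hole    = λ Sc≡e → ℕ.≤-reflexive (sym (label-hole Sc≡e))
      ; sorted  = λ c⇝d k≤c Sc≢e _ → sorted c⇝d (ℕ.≤∧≢⇒< k≤c λ k≡c → Sc≢e (at-hole (sym k≡c)))
      ; before  = λ c⇝d k≤c Sd≡e →
          contradiction (subst (_ <_) (label-hole Sd≡e) (⇝⇒label< c⇝d)) (ℕ.≤⇒≯ k≤c)
      ; after   = λ _ _ → z≤n
      ; initial = λ c<k → initial (ℕ.m<n⇒m<1+n c<k)
      }
      where
      open Sorted S-sorted
      at-hole : ∀ {c} → label c ≡ toℕ k → S ⟨$⟩ʳ c ≡ entry k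
      at-hole c≡k = trans (initial (s≤s (ℕ.≤-reflexive c≡k)))
        (cong (T ⟨$⟩ʳ_) (trans (sym (inverseˡ (tabloid P)))
                               (cong (tabloid P ⟨$⟩ˡ_) (Fin.toℕ-injective c≡k))))
      label-hole : ∀ {c} → S ⟨$⟩ʳ c ≡ entry k → label c ≡ toℕ k
      label-hole Sc≡e = trans (cong label (⟨$⟩ʳ-injective S (trans Sc≡e (sym (at-hole label-k))))) label-k
        where
        label-k : label (tabloid P ⟨$⟩ˡ k) ≡ toℕ k
        label-k = cong toℕ (inverseʳ (tabloid P))

    -- If nothing is exchanged, no successor of `entry k` holds v, and the bound in `after` rises by
    -- one. In an exchange v fits into the vacated cell: the predecessors there are smaller by
    -- `before`, the successors larger by `after`. Around the former cell of v, `sorted` gives the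
    -- new bounds, the vacated cell contributing v itself.
    sweeping-next : ∀ {k v S S′} → v Fin.< entry k → Exchange (entry k) v S S′ →
                    Sweeping k (toℕ v) S → Sweeping k (suc (toℕ v)) S′
    sweeping-next {k} {v} {S} v<e (kept e⇝̸v) I = record
      { hole    = hole
      ; sorted  = sorted
      ; before  = λ c⇝d k≤c Sd≡e → ℕ.m<n⇒m<1+n (before c⇝d k≤c Sd≡e)
      ; after   = λ c⇝d Sc≡e → ℕ.≤∧≢⇒< (after c⇝d Sc≡e) λ v≡Sd →
          e⇝̸v (subst₂ _⇝_ (trans (sym (inverseˡ S)) (cong (S ⟨$⟩ˡ_) Sc≡e))
                          (trans (sym (inverseˡ S)) (cong (S ⟨$⟩ˡ_) (sym (Fin.toℕ-injective v≡Sd)))) c⇝d)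
      ; initial = initial
      }
      where open Sweeping I
    sweeping-next {k} {v} {S} v<e (exchanged e⇝v) I = record
      { hole    = λ S′c≡e → hole′ (S′⁻¹e S′c≡e)
      ; sorted  = sorted′
      ; before  = before′
      ; after   = λ c⇝d S′c≡e → after′ c⇝d (S′⁻¹e S′c≡e)
      ; initial = λ {c} c<k → trans
          (S′-other (λ Sc≡e → ℕ.<⇒≱ c<k (hole Sc≡e)) (λ Sc≡v → ℕ.<⇒≱ c<k (hole′ Sc≡v))) (initial c<k)
      }
      where
      open Sweeping I
      e = entry k
      S′ = S ∘ₚ transpose e v

      v≢e : v ≢ e
      v≢e v≡e = ℕ.<-irrefl (cong toℕ v≡e) v<e

      S′-e : ∀ {c} → S ⟨$⟩ʳ c ≡ e → S′ ⟨$⟩ʳ c ≡ v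
      S′-e Sc≡e = trans (cong (Components.transpose e v) Sc≡e) (transpose-first e v)
      S′-v : ∀ {c} → S ⟨$⟩ʳ c ≡ v → S′ ⟨$⟩ʳ c ≡ e
      S′-v Sc≡v = trans (cong (Components.transpose e v) Sc≡v) (transpose-second e v)
      S′-other : ∀ {c} → S ⟨$⟩ʳ c ≢ e → S ⟨$⟩ʳ c ≢ v → S′ ⟨$⟩ʳ c ≡ S ⟨$⟩ʳ c
      S′-other = transpose-other

      S′⁻¹e : ∀ {c} → S′ ⟨$⟩ʳ c ≡ e → S ⟨$⟩ʳ c ≡ v
      S′⁻¹e S′c≡e = trans (sym (inverseˡ (transpose e v)))
        (trans (cong (Components.transpose v e) S′c≡e) (transpose-second v e))

      hole′ : ∀ {c} → S ⟨$⟩ʳ c ≡ v → toℕ k ≤ label c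
      hole′ {c} Sc≡v = ℕ.<⇒≤ (ℕ.≤-<-trans (hole (inverseʳ S))
        (subst (λ d → label (S ⟨$⟩ˡ e) < label d)
          (trans (cong (S ⟨$⟩ˡ_) (sym Sc≡v)) (inverseˡ S)) (⇝⇒label< e⇝v)))

      sorted′ : ∀ {c d} → c ⇝ d → toℕ k ≤ label c → S′ ⟨$⟩ʳ c ≢ e → S′ ⟨$⟩ʳ d ≢ e →
                S′ ⟨$⟩ʳ c Fin.< S′ ⟨$⟩ʳ d
      sorted′ {c} {d} c⇝d k≤c S′c≢e S′d≢e = compare (S ⟨$⟩ʳ c Fin.≟ e) (S ⟨$⟩ʳ d Fin.≟ e)
        where
        compare : Dec (S ⟨$⟩ʳ c ≡ e) → Dec (S ⟨$⟩ʳ d ≡ e) → S′ ⟨$⟩ʳ c Fin.< S′ ⟨$⟩ʳ d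
        compare (yes Sc≡e) (yes Sd≡e) =
          contradiction (⟨$⟩ʳ-injective S (trans Sc≡e (sym Sd≡e))) (⇝-irreflexive c⇝d)
        compare (yes Sc≡e) (no Sd≢e) =
          subst₂ Fin._<_ (sym (S′-e Sc≡e)) (sym (S′-other Sd≢e (S′d≢e ∘ S′-v)))
          (ℕ.≤∧≢⇒< (after c⇝d Sc≡e) (S′d≢e ∘ S′-v ∘ sym ∘ Fin.toℕ-injective))
        compare (no Sc≢e) (yes Sd≡e) =
          subst₂ Fin._<_ (sym (S′-other Sc≢e (S′c≢e ∘ S′-v))) (sym (S′-e Sd≡e))
          (before c⇝d k≤c Sd≡e)
        compare (no Sc≢e) (no Sd≢e) =
          subst₂ Fin._<_ (sym (S′-other Sc≢e (S′c≢e ∘ S′-v))) (sym (S′-other Sd≢e (S′d≢e ∘ S′-v)))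
            (sorted c⇝d k≤c Sc≢e Sd≢e)

      before′ : ∀ {c d} → c ⇝ d → toℕ k ≤ label c → S′ ⟨$⟩ʳ d ≡ e → toℕ (S′ ⟨$⟩ʳ c) < suc (toℕ v)
      before′ {c} {d} c⇝d k≤c S′d≡e = compare (S ⟨$⟩ʳ c Fin.≟ e)
        where
        Sd≡v : S ⟨$⟩ʳ d ≡ v
        Sd≡v = S′⁻¹e S′d≡e
        compare : Dec (S ⟨$⟩ʳ c ≡ e) → toℕ (S′ ⟨$⟩ʳ c) < suc (toℕ v)
        compare (yes Sc≡e) = s≤s (ℕ.≤-reflexive (cong toℕ (S′-e Sc≡e)))
        compare (no  Sc≢e) = ℕ.m<n⇒m<1+n (subst₂ Fin._<_
          (sym (S′-other Sc≢e λ Sc≡v →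
            ⇝-irreflexive c⇝d (⟨$⟩ʳ-injective S (trans Sc≡v (sym Sd≡v)))))
          Sd≡v (sorted c⇝d k≤c Sc≢e λ Sd≡e → v≢e (trans (sym Sd≡v) Sd≡e)))

      after′ : ∀ {c d} → c ⇝ d → S ⟨$⟩ʳ c ≡ v → suc (toℕ v) ≤ toℕ (S′ ⟨$⟩ʳ d)
      after′ {c} {d} c⇝d Sc≡v = subst₂ Fin._<_ Sc≡v (sym (S′-other Sd≢e λ Sd≡v →
          ⇝-irreflexive c⇝d (⟨$⟩ʳ-injective S (trans Sc≡v (sym Sd≡v)))))
        (sorted c⇝d (hole′ Sc≡v) (λ Sc≡e → v≢e (trans (sym Sc≡v) Sc≡e)) Sd≢e)
        where
        -- If d held e, `before` would give v < v.
        Sd≢e : S ⟨$⟩ʳ d ≢ e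
        Sd≢e Sd≡e = ℕ.<-irrefl (cong toℕ Sc≡v) (before c⇝d (hole′ Sc≡v) Sd≡e)

    -- At j = `entry k` the bounds `before` and `after` are comparisons with `entry k` itself, so
    -- the exception made for its cell disappears.
    sweeping-end : ∀ {k S} → Sweeping k (toℕ (entry k)) S → Sorted (toℕ k) S
    sweeping-end {k} {S} I = record { sorted = sorted′ ; initial = initial }
      where
      open Sweeping I
      sorted′ : ∀ {c d} → c ⇝ d → toℕ k ≤ label c → S ⟨$⟩ʳ c Fin.< S ⟨$⟩ʳ d
      sorted′ {c} {d} c⇝d k≤c with S ⟨$⟩ʳ c Fin.≟ entry k | S ⟨$⟩ʳ d Fin.≟ entry k
      ... | yes Sc≡e | _ = ℕ.≤∧≢⇒< (subst (Fin._≤ S ⟨$⟩ʳ d) (sym Sc≡e) (after c⇝d Sc≡e))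
        (⇝-irreflexive c⇝d ∘ ⟨$⟩ʳ-injective S ∘ Fin.toℕ-injective)
      ... | no _    | yes Sd≡e = subst (S ⟨$⟩ʳ c Fin.<_) (sym Sd≡e) (before c⇝d k≤c Sd≡e)
      ... | no Sc≢e | no Sd≢e  = sorted c⇝d k≤c Sc≢e Sd≢e

    sweeping : ∀ k {W} → Sorted (suc (toℕ k)) W → ∀ {j} → j ≤ toℕ (entry k) →
               Sweeping k j (sweep (entry k) W j)
    sweeping k {W} W-sorted j≤e = ascending
      (λ j → j ≤ toℕ (entry k) → Sweeping k j (sweep (entry k) W j))
      (λ _ → sweeping-start k W-sorted)
      (λ v ih v<e → sweeping-next v<e (sweep-suc (entry k) W v) (ih (ℕ.<⇒≤ v<e)))
      (ℕ.≤-trans j≤e (ℕ.<⇒≤ (Fin.toℕ<n (entry k)))) j≤e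

    -- When the sweep exchanges v, all neighbours are at least v by `successors`, so `step` makes
    -- the same exchange. The sweep thus agrees with i ≤ n steps; afterwards all neighbours are at
    -- least `entry k`, and the other n - i steps change nothing.
    jdt≡sweep : ∀ k {W} → Sorted (suc (toℕ k)) W →
                jdt (entry k) W ≡ sweep (entry k) W (toℕ (entry k))
    jdt≡sweep k {W} W-sorted with steps (ℕ.<⇒≤ (Fin.toℕ<n e)) ℕ.≤-refl
      where
      e = entry k
      steps : ∀ {j} → j ≤ n → j ≤ toℕ e → ∃ λ i → i ≤ j × sweep e W j ≡ fold W (step e) i
      steps = ascending (λ j → j ≤ toℕ e → ∃ λ i → i ≤ j × sweep e W j ≡ fold W (step e) i)
                        (λ _ → 0 , z≤n , refl) next
        where
        next : ∀ (v : Fin n) →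
               (toℕ v ≤ toℕ e → ∃ λ i → i ≤ toℕ v × sweep e W (toℕ v) ≡ fold W (step e) i) →
               v Fin.< e → ∃ λ i → i ≤ suc (toℕ v) × sweep e W (suc (toℕ v)) ≡ fold W (step e) i
        next v ih v<e with ih (ℕ.<⇒≤ v<e)
        ... | i , i≤v , eq with sweep e W (suc (toℕ v)) | sweep-suc e W v
        ...   | _ | exchanged e⇝v = suc i , s≤s i≤v ,
          trans (sym (step-exchange _ e⇝v (Sweeping.successors (sweeping k W-sorted (ℕ.<⇒≤ v<e))) v<e))
                (cong (step e) eq)
        ...   | _ | kept _ = i , ℕ.m≤n⇒m≤1+n i≤v , eq
    ... | i , i≤e , eq = begin
      fold W (step e) n                          ≡⟨ cong (fold W (step e)) (ℕ.m∸n+n≡m i≤n) ⟨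
      fold W (step e) (n ∸ i + i)                ≡⟨ fold-+ W (step e) (n ∸ i) ⟩
      fold (fold W (step e) i) (step e) (n ∸ i)  ≡⟨ cong (λ S → fold S (step e) (n ∸ i)) eq ⟨
      fold S (step e) (n ∸ i)                    ≡⟨ fold-fixed (n ∸ i) ⟩
      S                                          ∎
      where
      open ≡-Reasoning
      e = entry k
      S = sweep e W (toℕ e)
      i≤n = ℕ.≤-trans i≤e (ℕ.<⇒≤ (Fin.toℕ<n e))
      fold-fixed : ∀ m → fold S (step e) m ≡ S
      fold-fixed zero    = refl
      fold-fixed (suc m) = trans (cong (step e) (fold-fixed m))
        (step-settled S (Sweeping.successors (sweeping k W-sorted ℕ.≤-refl)))

    -- The grid of a run.

    -- `foldr` treats the last label first, so dropping k labels leaves the state before the labels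
    -- below k are treated. `W 0` is `MJ P T` by definition, whence `end` is `refl`.
    W : ℕ → Tabloid
    W k = foldr (λ i → jdt (entry i)) T (drop k (allFin n))

    S : Fin n → ℕ → Tabloid
    S k = sweep (entry k) (W (suc (toℕ k)))

    W-jdt : ∀ k → W (toℕ k) ≡ jdt (entry k) (W (suc (toℕ k)))
    W-jdt k = cong (foldr (λ i → jdt (entry i)) T) (drop-tabulate (λ i → i) k)

    W-n : W n ≡ T
    W-n = cong (foldr (λ i → jdt (entry i)) T)
      (List.drop-all n (allFin n) (ℕ.≤-reflexive (List.length-tabulate (λ i → i))))

    W-sorted : ∀ {k} → k ≤ n → Sorted k (W k)
    W-sorted = descending (λ k → Sorted k (W k))
      (subst (Sorted n) (sym W-n) (record
        { sorted  = λ {c} _ n≤c → contradiction (Fin.toℕ<n (tabloid P ⟨$⟩ʳ c)) (ℕ.≤⇒≯ n≤c)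
        ; initial = λ _ → refl }))
      (λ k sorted → subst (Sorted (toℕ k)) (sym (trans (W-jdt k) (jdt≡sweep k sorted)))
        (sweeping-end (sweeping k sorted ℕ.≤-refl)))

    W≡S : ∀ k → W (toℕ k) ≡ S k (toℕ (entry k))
    W≡S k = trans (W-jdt k) (jdt≡sweep k (W-sorted (Fin.toℕ<n k)))

    S-sweeping : ∀ k {j} → j ≤ toℕ (entry k) → Sweeping k j (S k j)
    S-sweeping k = sweeping k (W-sorted (Fin.toℕ<n k))

    grid : Grid (tabloid P) (MJ P T) entries
    grid = record
      { X      = X
      ; Y      = Y
      ; start  = start
      ; end    = λ _ → refl
      ; turn   = λ k → cong (_⟨$⟩ˡ entry k) (W≡S k)
      ; square = square
      ; Y-pass = Y-pass
      ; X-pass = X-pass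
      }
      where
      X : ℕ → Fin n → Cell
      X k v = W k ⟨$⟩ˡ v

      Y : Fin n → ℕ → Cell
      Y k j = S k j ⟨$⟩ˡ entry k

      start : ∀ k → Y k 0 ≡ tabloid P ⟨$⟩ˡ k
      start k = trans
        (initial-cell {S = W (suc (toℕ k))} (Sorted.initial (W-sorted (Fin.toℕ<n k)))
          (ℕ.≤-reflexive (cong (suc ∘ toℕ) (inverseˡ entries))))
        (inverseˡ T)

      S-keeps : ∀ k {i j v} → v ≢ entry k → i ≤ j → j ≤ toℕ (entry k) →
                (∀ {u} → i ≤ toℕ u → toℕ u < j → v ≢ u) → S k j ⟨$⟩ˡ v ≡ S k i ⟨$⟩ˡ v
      S-keeps k v≢e i≤j j≤e = sweep-keeps v≢e i≤j (ℕ.≤-trans j≤e (ℕ.<⇒≤ (Fin.toℕ<n (entry k))))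

      square : ∀ {k v} → v Fin.< entry k → k Fin.< entries ⟨$⟩ˡ v →
               Square (Y k (toℕ v)) (X (suc (toℕ k)) v) (Y k (suc (toℕ v))) (X (toℕ k) v)
      square {k} {v} v<e k<f =
        -- `X` records the cell of v before and after the whole sweep; v moves at most in its own
        -- comparison, so these are also its cells just before and after that comparison.
        subst₂ (λ x x′ → Square (Y k (toℕ v)) x (Y k (suc (toℕ v))) x′)
          (S-keeps k v≢e z≤n (ℕ.<⇒≤ v<e) λ _ u<v v≡u → ℕ.<-irrefl (cong toℕ (sym v≡u)) u<v)
          (sym (trans (cong (_⟨$⟩ˡ v) (W≡S k))
            (S-keeps k v≢e v<e ℕ.≤-refl λ v<u _ v≡u → ℕ.<-irrefl (cong toℕ v≡u) v<u)))
          (exchange-square v⇝̸e (sweep-suc (entry k) (W (suc (toℕ k))) v))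
        where
        open Sweeping (S-sweeping k (ℕ.<⇒≤ v<e))
        v≢e : v ≢ entry k
        v≢e v≡e = ℕ.<-irrefl (cong toℕ v≡e) v<e
        -- A cell of v just before that of `entry k` would give v < v by `before`.
        v⇝̸e : ¬ ((S k (toℕ v) ⟨$⟩ˡ v) ⇝ (S k (toℕ v) ⟨$⟩ˡ entry k))
        v⇝̸e v⇝e = ℕ.<-irrefl (cong toℕ (inverseʳ (S k (toℕ v))))
          (before v⇝e (inside (ℕ.<⇒≤ k<f)) (inverseʳ (S k (toℕ v))))

      -- Here v is still in its original cell, labelled below k, whereas every successor of the cell
      -- of `entry k` has a label above k.
      Y-pass : ∀ {k v} → v Fin.< entry k → entries ⟨$⟩ˡ v Fin.< k → Y k (suc (toℕ v)) ≡ Y k (toℕ v)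
      Y-pass {k} {v} v<e f<k with S k (suc (toℕ v)) | sweep-suc (entry k) (W (suc (toℕ k))) v
      ... | _ | kept _        = refl
      ... | _ | exchanged e⇝v = contradiction
        (ℕ.<-trans (ℕ.≤-<-trans (hole (inverseʳ (S k (toℕ v)))) (⇝⇒label< e⇝v))
          (subst (λ c → label c < toℕ k) (sym (initial-cell {S = S k (toℕ v)} initial f<k)) f<k))
        (ℕ.<-irrefl refl)
        where open Sweeping (S-sweeping k (ℕ.<⇒≤ v<e))

      -- The sweep ends at `entry k`, before it would reach v.
      X-pass : ∀ {k v} → k Fin.< entries ⟨$⟩ˡ v → entry k Fin.< v → X (suc (toℕ k)) v ≡ X (toℕ k) v
      X-pass {k} {v} _ e<v = sym (trans (cong (_⟨$⟩ˡ v) (W≡S k))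
        (S-keeps k (λ v≡e → ℕ.<-irrefl (cong toℕ (sym v≡e)) e<v) z≤n ℕ.≤-refl
          λ _ u<e v≡u → ℕ.<-asym u<e (subst (entry k Fin.<_) v≡u e<v)))

  -- Dual tabloids and the equality of the counts.

  open Run using (entries; grid)

  -- The two runs give grids with the same `P` and pointwise equal permutations, so no comparison of
  -- individual slides is made.
  MJ-cong : ∀ P {T T′} → T ≈ T′ → MJ P T ≈ MJ P T′
  MJ-cong P {T} {T′} T≈T′ = grid-unique {e = entries P T} {entries P T′}
    (λ k → T≈T′ (tabloid P ⟨$⟩ˡ k)) (grid P T) (grid P T′)

  -- Chosen so that `entries Q (dual P Q T)` is the inverse of `entries P T`.
  dual : StandardTableau → StandardTableau → Tabloid → Tabloid
  dual P Q T = tabloid Q ∘ₚ flip (entries P T)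

  -- The transposed grid of `T` and the grid of the dual run both start from `Q` with the same
  -- permutation, so `grid-unique` identifies their ends.
  MJ-dual : ∀ P Q {T} → MJ P T ≈ tabloid Q → MJ Q (dual P Q T) ≈ tabloid P
  MJ-dual P Q {T} MJ≈Q = grid-unique {e = entries Q (dual P Q T)} {flip (entries P T)}
    (λ j → cong (entries P T ⟨$⟩ˡ_) (inverseʳ (tabloid Q)))
    (grid Q (dual P Q T))
    (grid-transpose {tabloid P} {tabloid Q} (record
      { Grid (grid P T) ; end = λ j → ≈-inverse {π = MJ P T} {tabloid Q} MJ≈Q j }))

  dual-injective : ∀ P Q {T T′} → dual P Q T ≈ dual P Q T′ → T ≈ T′
  dual-injective P Q {T} {T′} eq = inverse-≈ {π = T} {T′} λ v →
    ⟨$⟩ʳ-injective (tabloid P) (begin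
      entries P T ⟨$⟩ˡ v                   ≡⟨ cong (entries P T ⟨$⟩ˡ_) (inverseʳ (tabloid Q)) ⟨
      dual P Q T ⟨$⟩ʳ (tabloid Q ⟨$⟩ˡ v)   ≡⟨ eq (tabloid Q ⟨$⟩ˡ v) ⟩
      dual P Q T′ ⟨$⟩ʳ (tabloid Q ⟨$⟩ˡ v)  ≡⟨ cong (entries P T′ ⟨$⟩ˡ_) (inverseʳ (tabloid Q)) ⟩
      entries P T′ ⟨$⟩ˡ v                  ∎)
    where open ≡-Reasoning

  open SetoidMembership (Permutations n) using (_∈_)

  A-≤ : ∀ P Q → A P Q ≤ A Q P
  A-≤ P Q = length-injection (Permutations n) (dual P Q)
    (SetoidUniqueₚ.filter⁺ (Permutations n) _ (permutations-unique n))
    (λ {T} {T′} → dual-injective P Q {T} {T′}) (λ {T} → dual∈ {T})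
    where
    resp : ∀ P Q {T T′} → T ≈ T′ → MJ P T ≈ tabloid Q → MJ P T′ ≈ tabloid Q
    resp P Q {T} {T′} T≈T′ MJ≈Q i = trans (sym (MJ-cong P {T} {T′} T≈T′ i)) (MJ≈Q i)

    dual∈ : ∀ {T} → T ∈ filter (λ T → MJ P T ≈? tabloid Q) (permutations n) →
            dual P Q T ∈ filter (λ T → MJ Q T ≈? tabloid P) (permutations n)
    dual∈ {T} T∈ = SetoidMembershipₚ.∈-filter⁺ (Permutations n) _
      (λ {T} {T′} → resp Q P {T} {T′}) (permutations-complete (dual P Q T))
      (MJ-dual P Q {T} (proj₂ (SetoidMembershipₚ.∈-filter⁻ (Permutations n) _
        (λ {T} {T′} → resp P Q {T} {T′}) {v = T} {permutations n} T∈)))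

open import Defs using (Kind; SkewShape; StandardTableau; A; cells-unique; row; col)

lookup-cells-injective : ∀ {kind} (shape : SkewShape kind) {c d} →
                         row shape c ≡ row shape d → col shape c ≡ col shape d → c ≡ d
lookup-cells-injective shape r s = lookup-injective (setoid _) (cells-unique shape)
  (cong₂ _,_ (Fin.toℕ-injective r) s)

corollary1 : (kind : Kind) (shape : SkewShape kind) (P Q : StandardTableau shape) →
    A shape P Q ≡ A shape Q P
corollary1 kind shape P Q = ℕ.≤-antisym (A-≤ P Q) (A-≤ Q P)
  where open Symmetry (row shape) (col shape) (lookup-cells-injective shape)
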